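{- Let $A$ be a finite alphabet. A language $L\subseteq A^*$ is definable by a sentence of $FO^2[<,\mathrm{Inv}]$ if and only if it is definable by a sentence of $FO^2[<,\mathrm{Th}]$. That is, as language classes, $FO^2[<,\mathrm{Inv}]=FO^2[<,\mathrm{Th}]$.
   Context: Words $w\in A^*$ are finite structures whose universe is the set of positions $\{1,\dots,|w|\}$; $w(i)$ denotes the $i$-th letter. For each $a\in A$ there is a unary predicate $a(x)$, true iff the letter at position $x$ is $a$, and the order $<$ on positions. A sentence $\phi$ defines the language $\{w\in A^*: w\models\phi\}$; formulas may be interpreted in the empty word, where every existentially quantified sentence is false and every universally quantified one is true. For $a\in A$, the binary "between" predicate $a(x,y)$ means $\exists z\,(x<z\wedge z<y\wedge a(z))$, i.e. the letter $a$ occurs strictly between positions $x$ and $y$. $FO^2[<,\mathrm{Inv}]$ is the set of first-order formulas built from $<$, the unary predicates $a(x)$ and the binary predicates $a(x,y)$ ($a\in A$) using only two variables (which may be reused). For $a\in A$ and $k\ge 0$, the predicate $(a,k)(x,y)$ means that $x<y$ and there are at least $k$ positions $z$ with $x<z<y$ and $w(z)=a$. $FO^2[<,\mathrm{Th}]$ is the two-variable logic built from $<$, the unary predicates $a(x)$, and all predicates $(a,k)(x,y)$ ($a\in A$, $k\ge 0$). -}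

module Defs where

open import Data.Empty using (⊥-elim)
open import Data.Fin.Base using (Fin; _<_)
open import Data.Fin.Properties using (_≟_)
open import Data.Fin.Subset using (Subset; _∈_; _∪_; ⁅_⁆; ⊥; ∣_∣)
open import Data.Fin.Subset.Properties using (∉⊥; x∈p∪q⁻; x∈⁅y⁆⇒x≡y)
open import Data.List.Base using (List; length; lookup)
open import Data.Nat.Base using (ℕ; _≤_)
open import Data.Product.Base using (Σ-syntax; ∃-syntax; _×_; _,_)
open import Data.Sum.Base using (_⊎_; inj₁; inj₂)
open import Level using (Level)
open import Relation.Binary.PropositionalEquality using (_≡_)
open import Relation.Nullary using (¬_; yes; no; contradiction)
open import Relation.Unary using (Pred; _≐_)

private
  variable
    ℓ : Level
    A : Set

Word : Set → Set
Word A = List A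

-- Positions are numbered from 0.
Pos : Word A → Set
Pos w = Fin (length w)

-- The binary predicate symbols available besides _<_ and equality.
record Vocabulary (A : Set) : Set₁ where
  field
    Symbol : Set
    interp : Symbol → (w : Word A) → Pos w → Pos w → Set

open Vocabulary public

OccursBetween : A → (w : Word A) → Pos w → Pos w → Pos w → Set
OccursBetween a w i j k = i < k × k < j × lookup w k ≡ a

Between : A → (w : Word A) → Pos w → Pos w → Set
Between a w i j = ∃[ k ] OccursBetween a w i j k

AtLeast : A → ℕ → (w : Word A) → Pos w → Pos w → Set
AtLeast a n w i j =
  i < j ×
  (Σ[ S ∈ Subset (length w) ]
     (n ≤ ∣ S ∣ × (∀ k → k ∈ S → OccursBetween a w i j k)))

Inv : (A : Set) → Vocabulary A
Inv A = record { Symbol = A ; interp = Between }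

Th : (A : Set) → Vocabulary A
Th A = record { Symbol = A × ℕ ; interp = λ (a , n) → AtLeast a n }

Var : Set
Var = Fin 2

Scope : Set
Scope = Subset 2

-- Formula V Γ: two-variable formulas whose free variables all lie in Γ.
-- A quantifier may rebind a variable already in Γ.
data Formula {A : Set} (V : Vocabulary A) : Scope → Set where
  letter  : ∀ {Γ} → A → (u : Var) → u ∈ Γ → Formula V Γ
  less    : ∀ {Γ} (u v : Var) → u ∈ Γ → v ∈ Γ → Formula V Γ
  equal   : ∀ {Γ} (u v : Var) → u ∈ Γ → v ∈ Γ → Formula V Γ
  rel     : ∀ {Γ} → Symbol V → (u v : Var) → u ∈ Γ → v ∈ Γ → Formula V Γ
  neg     : ∀ {Γ} → Formula V Γ → Formula V Γ
  and or  : ∀ {Γ} → Formula V Γ → Formula V Γ → Formula V Γ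
  all′ ex : ∀ {Γ} (v : Var) → Formula V (⁅ v ⁆ ∪ Γ) → Formula V Γ

Sentence : Vocabulary A → Set
Sentence V = Formula V ⊥

-- Only the variables in scope have values (positions in a word of length n), so
-- the empty word needs no special treatment: its one assignment is the empty one.
Env : Scope → ℕ → Set
Env Γ n = (u : Var) → u ∈ Γ → Fin n

emptyEnv : ∀ {n} → Env ⊥ n
emptyEnv u u∈⊥ = ⊥-elim (∉⊥ u∈⊥)

infixl 6 _[_↦_]

_[_↦_] : ∀ {n Γ} → Env Γ n → (v : Var) → Fin n → Env (⁅ v ⁆ ∪ Γ) n
_[_↦_] {Γ = Γ} ρ v i u u∈ with u ≟ v
... | yes _  = i
... | no u≢v with x∈p∪q⁻ ⁅ v ⁆ Γ u∈
...   | inj₁ u∈⁅v⁆ = contradiction (x∈⁅y⁆⇒x≡y v u∈⁅v⁆) u≢v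
...   | inj₂ u∈Γ   = ρ u u∈Γ

-- When A has decidable equality, every clause is decidable for Inv A and Th A
-- (quantifiers range over finite sets), so this agrees with classical semantics.
Sat : {V : Vocabulary A} {Γ : Scope} (w : Word A) → Env Γ (length w) →
      Formula V Γ → Set
Sat w ρ (letter a u p)            = lookup w (ρ u p) ≡ a
Sat w ρ (less u v p q)            = ρ u p < ρ v q
Sat w ρ (equal u v p q)           = ρ u p ≡ ρ v q
Sat {V = V} w ρ (rel R u v p q)   = interp V R w (ρ u p) (ρ v q)
Sat w ρ (neg φ)                   = ¬ Sat w ρ φ
Sat w ρ (and φ ψ)                 = Sat w ρ φ × Sat w ρ ψ
Sat w ρ (or φ ψ)                  = Sat w ρ φ ⊎ Sat w ρ ψ
Sat w ρ (all′ v φ)                = (i : Pos w) → Sat w (ρ [ v ↦ i ]) φ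
Sat w ρ (ex v φ)                  = ∃[ i ] Sat w (ρ [ v ↦ i ]) φ

infix 4 _⊨_

_⊨_ : {V : Vocabulary A} → Word A → Sentence V → Set
w ⊨ φ = Sat w emptyEnv φ

Definable : Vocabulary A → Pred (Word A) ℓ → Set ℓ
Definable V L = Σ[ φ ∈ Sentence V ] L ≐ (_⊨ φ)

{-# OPTIONS --safe #-}
-- The nontrivial inclusion eliminates a quantifier ∃y from a Boolean combination of unary
-- properties of x, unary properties of y and binary atoms. Once the order of x and y and,
-- for every letter, either its exact number of occurrences between them or a lower bound
-- for it are fixed, such a y is found by walking from x through the occurrences that are
-- needed, guessing their letters in order: between consecutive stops no letter whose
-- count is exact may occur, and that is expressible with the predicates a(x,y). Each stop
-- reuses the variable that is no longer needed.
module Submission where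

open import Defs
open import Algebra.Properties.CommutativeSemigroup using (interchange)
open import Data.Bool.Base using (Bool; true; false; T; if_then_else_)
open import Data.Bool.Properties using (T?)
open import Data.Empty using (⊥-elim)
import Data.Fin.Base as Fin
open import Data.Fin.Base using (Fin; zero; suc)
import Data.Fin.Induction as Fin
import Data.Fin.Properties as Fin
open import Data.Fin.Subset as Subset using (Subset; inside; outside; ∣_∣; ⁅_⁆; _∪_)
open import Data.Fin.Subset.Properties
  using (∉⊥; x∈p∪q⁻; x∈p∪q⁺; x∈⁅x⁆; x∈⁅y⁆⇒x≡y; ∣⁅x⁆∣≡1; ∣⊥∣≡0; nonempty?; Empty-unique)
open import Data.List.Base using (List; []; _∷_; lookup; map; foldr; filter; allFin; applyUpTo)
open import Data.List.Membership.Propositional using (_∈_)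
open import Data.List.Membership.Propositional.Properties
  using (∈-map⁺; ∈-filter⁺; ∈-filter⁻; ∈-allFin; ∈-applyUpTo⁺; ∈-applyUpTo⁻)
import Data.List.Relation.Unary.All as All
open import Data.List.Relation.Unary.Any using (here; there)
open import Data.Maybe.Base as Maybe using (Maybe; nothing; just)
import Data.Maybe.Properties as Maybe
open import Data.Nat.Base using (ℕ; zero; suc; _+_; _∸_; _⊔_; _≤_; _<_; z≤n; s≤s)
open import Data.Nat.ListAction using (sum)
import Data.Nat.Properties as ℕ
open import Data.Nat.Properties hiding (_≟_)
open import Data.Product.Base using (∃-syntax; _×_; _,_; proj₁; proj₂)
open import Data.Product.Function.NonDependent.Propositional using (_×-⇔_)
open import Data.Sum.Base using (_⊎_; inj₁; inj₂; [_,_]; swap)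
open import Data.Sum.Function.Propositional using (_⊎-⇔_)
open import Data.Vec.Base as Vec using (tabulate)
open import Data.Vec.Properties using (lookup∘tabulate; []=⇒lookup)
open import Function.Base using (_∘_; id)
open import Function.Bundles using (_↔_; _⇔_; mk⇔; Equivalence; Inverse)
open import Function.Construct.Composition using (_⇔-∘_)
open import Function.Construct.Identity using (⇔-id)
open import Function.Construct.Symmetry using (⇔-sym)
open import Function.Properties.Inverse using (↔⇒↣)
open import Function.Related.TypeIsomorphisms using (¬-cong-⇔)
open import Induction.WellFounded using (Acc; acc; WellFounded)
open import Level using (Level; 0ℓ)
open import Relation.Binary.Definitions using (DecidableEquality; tri<; tri≈; tri>)
open import Relation.Binary.PropositionalEquality using (_≡_; _≢_; refl; sym; trans; cong; cong₂; subst)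
open import Relation.Nullary using (¬_; Dec; yes; no; does; contradiction)
open import Relation.Nullary.Decidable
  using (_×-dec_; _⊎-dec_; ¬?; _→-dec_; dec-true; dec-false; via-injection; decidable-stable)
open import Relation.Unary using (Pred; Decidable)
open import Relation.Unary.Properties using (∅?)

open Equivalence using (to; from)

-- With two variables, a subformula that starts with a quantifier depends on at most one position.
-- It can be replaced by a unary property of that position, so only quantifier-free trees ever
-- relate two positions, and eliminating a single quantifier is enough.
--
-- The obstacle is that nothing can refer to x again once the walk has left it, so a count that
-- starts at x cannot be checked later. The remedy is to keep the outstanding demand in the
-- parameters: each stop lowers `need` for its own letter, and what remains is a condition of the
-- same shape on the new position and y. Every stop is the nearest position whose letter is still
-- needed. Hence a letter with an exact count cannot occur in the gap before it: if still needed, it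
-- would itself be the stop; if not, it must not occur again. A letter with only a lower bound
-- becomes unconstrained once its need is zero.
--
-- Bounds of this form suffice because "fewer than k" is a finite disjunction of exact counts.

private variable
  A X : Set
  Γ : Scope

-- Counting the elements of a decidable predicate on a finite set

indicator : ∀ {P : Set} → Dec P → ℕ
indicator P? = if does P? then 1 else 0

indicator-yes : ∀ {P : Set} (P? : Dec P) → P → indicator P? ≡ 1
indicator-yes (yes _) p = refl
indicator-yes (no ¬p) p = contradiction p ¬p

indicator-no : ∀ {P : Set} (P? : Dec P) → ¬ P → indicator P? ≡ 0
indicator-no (yes p) ¬p = contradiction p ¬p
indicator-no (no _)  ¬p = refl

indicator-⊎ : ∀ {P Q R : Set} (P? : Dec P) (Q? : Dec Q) (R? : Dec R) →
              (P → Q ⊎ R) → (Q → P) → (R → P) → (Q → ¬ R) →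
              indicator P? ≡ indicator Q? + indicator R?
indicator-⊎ P? (yes q) R?      _ q→p _   disj =
  trans (indicator-yes P? (q→p q)) (cong suc (sym (indicator-no R? (disj q))))
indicator-⊎ P? (no _)  (yes r) _ _   r→p _    = indicator-yes P? (r→p r)
indicator-⊎ P? (no ¬q) (no ¬r) split _ _ _    = indicator-no P? ([ ¬q , ¬r ] ∘ split)

card : ∀ {n} {P : Pred (Fin n) 0ℓ} → Decidable P → ℕ
card {zero}  P? = 0
card {suc n} P? = indicator (P? zero) + card (P? ∘ suc)

card-⊎ : ∀ {n} {P Q R : Pred (Fin n) 0ℓ} (P? : Decidable P) (Q? : Decidable Q) (R? : Decidable R) →
         (∀ {k} → P k → Q k ⊎ R k) → (∀ {k} → Q k → P k) → (∀ {k} → R k → P k) →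
         (∀ {k} → Q k → ¬ R k) → card P? ≡ card Q? + card R?
card-⊎ {zero}  P? Q? R? _ _ _ _ = refl
card-⊎ {suc n} P? Q? R? split q→p r→p disj =
  trans (cong₂ _+_ (indicator-⊎ (P? zero) (Q? zero) (R? zero) split q→p r→p disj)
                   (card-⊎ (P? ∘ suc) (Q? ∘ suc) (R? ∘ suc) split q→p r→p disj))
        (interchange +-commutativeSemigroup (indicator (Q? zero)) (indicator (R? zero)) _ _)

card-none : ∀ {n} {P : Pred (Fin n) 0ℓ} (P? : Decidable P) → (∀ k → ¬ P k) → card P? ≡ 0
card-none {zero}  P? ¬P = refl
card-none {suc n} P? ¬P = cong₂ _+_ (indicator-no (P? zero) (¬P zero)) (card-none (P? ∘ suc) (¬P ∘ suc))

-- The case of `card-⊎` in which one of the two parts is empty.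
card-cong : ∀ {n} {P Q : Pred (Fin n) 0ℓ} (P? : Decidable P) (Q? : Decidable Q) →
            (∀ {k} → P k → Q k) → (∀ {k} → Q k → P k) → card P? ≡ card Q?
card-cong {n} P? Q? p→q q→p =
  trans (card-⊎ P? Q? ∅? (inj₁ ∘ p→q) q→p ⊥-elim (λ _ ()))
        (trans (cong (card Q? +_) (card-none {n} ∅? λ _ ())) (+-identityʳ _))

card-some : ∀ {n} {P : Pred (Fin n) 0ℓ} (P? : Decidable P) k → P k → 0 < card P?
card-some P? zero    p rewrite indicator-yes (P? zero) p = s≤s z≤n
card-some P? (suc k) p = ≤-trans (card-some (P? ∘ suc) k p) (m≤n+m _ (indicator (P? zero)))

card-unique : ∀ {n} {P : Pred (Fin n) 0ℓ} (P? : Decidable P) z → P z → (∀ k → P k → k ≡ z) → card P? ≡ 1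
card-unique P? zero    p unique =
  cong₂ _+_ (indicator-yes (P? zero) p)
            (card-none (P? ∘ suc) λ k q → contradiction (unique (suc k) q) λ ())
card-unique P? (suc z) p unique =
  cong₂ _+_ (indicator-no (P? zero) λ q → contradiction (unique zero q) λ ())
            (card-unique (P? ∘ suc) z p λ k q → Fin.suc-injective (unique (suc k) q))

∣S∣≤card : ∀ {n} {P : Pred (Fin n) 0ℓ} (P? : Decidable P) (S : Subset n) →
           (∀ k → k Subset.∈ S → P k) → ∣ S ∣ ≤ card P?
∣S∣≤card P? Vec.[]              S⊆P = z≤n
∣S∣≤card P? (outside Vec.∷ S) S⊆P =
  ≤-trans (∣S∣≤card (P? ∘ suc) S λ k k∈S → S⊆P (suc k) (Vec.there k∈S)) (m≤n+m _ _)
∣S∣≤card P? (inside Vec.∷ S)  S⊆P rewrite indicator-yes (P? zero) (S⊆P zero Vec.here) =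
  s≤s (∣S∣≤card (P? ∘ suc) S λ k k∈S → S⊆P (suc k) (Vec.there k∈S))

-- With `∣S∣≤card`, this makes the set of all positions satisfying `P` the largest candidate for the
-- subset in `AtLeast`, so that the search for a subset becomes a comparison of numbers.
∣tabulate∣≡card : ∀ {n} {P : Pred (Fin n) 0ℓ} (P? : Decidable P) → ∣ tabulate (does ∘ P?) ∣ ≡ card P?
∣tabulate∣≡card {zero}  P? = refl
∣tabulate∣≡card {suc n} P? with does (P? zero)
... | true  = cong suc (∣tabulate∣≡card (P? ∘ suc))
... | false = ∣tabulate∣≡card (P? ∘ suc)

∈tabulate⁻ : ∀ {n} {P : Pred (Fin n) 0ℓ} (P? : Decidable P) k → k Subset.∈ tabulate (does ∘ P?) → P k
∈tabulate⁻ P? k k∈ with P? k | trans (sym (lookup∘tabulate (does ∘ P?) k)) ([]=⇒lookup k∈)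
... | yes p | _ = p
... | no _  | ()

-- Betweenness

-- Symmetric in i and j, so that one argument serves both directions.
Amid : ∀ {n} → Fin n → Fin n → Fin n → Set
Amid i j k = (i Fin.< k × k Fin.< j) ⊎ (j Fin.< k × k Fin.< i)

amid? : ∀ {n} (i j k : Fin n) → Dec (Amid i j k)
amid? i j k = ((i Fin.<? k) ×-dec (k Fin.<? j)) ⊎-dec ((j Fin.<? k) ×-dec (k Fin.<? i))

amid-split : ∀ {n} {i j z : Fin n} → Amid i j z → ∀ k → Amid i j k → Amid i z k ⊎ k ≡ z ⊎ Amid z j k
amid-split {z = z} _ k _ with Fin.<-cmp k z
amid-split (inj₁ _)            k (inj₁ (i<k , _))   | tri< k<z _ _ = inj₁ (inj₁ (i<k , k<z))
amid-split (inj₁ (i<z , z<j))  k (inj₂ (j<k , k<i)) | _            =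
  contradiction (<-trans (<-trans i<z z<j) (<-trans j<k k<i)) (<-irrefl refl)
amid-split (inj₂ (j<z , z<i))  k (inj₁ (i<k , k<j)) | _            =
  contradiction (<-trans (<-trans j<z z<i) (<-trans i<k k<j)) (<-irrefl refl)
amid-split (inj₂ _)            k (inj₂ (j<k , _))   | tri< k<z _ _ = inj₂ (inj₂ (inj₂ (j<k , k<z)))
amid-split _                   k _                  | tri≈ _ k≡z _ = inj₂ (inj₁ k≡z)
amid-split (inj₁ _)            k (inj₁ (_ , k<j))   | tri> _ _ z<k = inj₂ (inj₂ (inj₁ (z<k , k<j)))
amid-split (inj₂ _)            k (inj₂ (_ , k<i))   | tri> _ _ z<k = inj₁ (inj₂ (z<k , k<i))

amid-left : ∀ {n} {i j z k : Fin n} → Amid i j z → Amid i z k → Amid i j k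
amid-left (inj₁ (_ , z<j))   (inj₁ (i<k , k<z)) = inj₁ (i<k , <-trans k<z z<j)
amid-left (inj₁ (i<z , _))   (inj₂ (z<k , k<i)) =
  contradiction (<-trans i<z (<-trans z<k k<i)) (<-irrefl refl)
amid-left (inj₂ (_ , z<i))   (inj₁ (i<k , k<z)) =
  contradiction (<-trans z<i (<-trans i<k k<z)) (<-irrefl refl)
amid-left (inj₂ (j<z , _))   (inj₂ (z<k , k<i)) = inj₂ (<-trans j<z z<k , k<i)

amid-right : ∀ {n} {i j z k : Fin n} → Amid i j z → Amid z j k → Amid i j k
amid-right p q = swap (amid-left (swap p) (swap q))

amid-irrefl : ∀ {n} {i j : Fin n} → ¬ Amid i j j
amid-irrefl (inj₁ (_ , j<j)) = <-irrefl refl j<j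
amid-irrefl (inj₂ (j<j , _)) = <-irrefl refl j<j

amid-same : ∀ {n} {i k : Fin n} → ¬ Amid i i k
amid-same (inj₁ (i<k , k<i)) = <-asym i<k k<i
amid-same (inj₂ (i<k , k<i)) = <-asym i<k k<i

amid-disjoint : ∀ {n} {i j z k : Fin n} → Amid i j z → Amid i z k → ¬ Amid z j k
amid-disjoint _                 (inj₁ (_ , k<z))   (inj₁ (z<k , _))   = <-asym k<z z<k
amid-disjoint (inj₁ (_ , z<j))  (inj₁ _)           (inj₂ (j<k , k<z)) = <-irrefl refl (<-trans z<j (<-trans j<k k<z))
amid-disjoint (inj₂ (_ , z<i))  (inj₁ (i<k , k<z)) _                  = <-irrefl refl (<-trans z<i (<-trans i<k k<z))
amid-disjoint (inj₁ (i<z , _))  (inj₂ (z<k , k<i)) _                  = <-irrefl refl (<-trans i<z (<-trans z<k k<i))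
amid-disjoint (inj₂ (j<z , _))  (inj₂ _)           (inj₁ (z<k , k<j)) = <-irrefl refl (<-trans j<z (<-trans z<k k<j))
amid-disjoint _                 (inj₂ (z<k , _))   (inj₂ (_ , k<z))   = <-asym k<z z<k

-- Directions and nearest positions

data Dir : Set where
  fwd bwd : Dir

_≟ᵈ_ : DecidableEquality Dir
fwd ≟ᵈ fwd = yes refl
fwd ≟ᵈ bwd = no λ ()
bwd ≟ᵈ fwd = no λ ()
bwd ≟ᵈ bwd = yes refl

Before : ∀ {n} → Dir → Fin n → Fin n → Set
Before fwd i j = i Fin.< j
Before bwd i j = j Fin.< i

before? : ∀ {n} d (i j : Fin n) → Dec (Before d i j)
before? fwd i j = i Fin.<? j
before? bwd i j = j Fin.<? i

before⇒amid : ∀ {n} d {i j z : Fin n} → Before d i z → Before d z j → Before d i j × Amid i j z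
before⇒amid fwd i<z z<j = <-trans i<z z<j , inj₁ (i<z , z<j)
before⇒amid bwd z<i j<z = <-trans j<z z<i , inj₂ (j<z , z<i)

amid⇒before : ∀ {n} d {i j z : Fin n} → Before d i j → Amid i j z → Before d i z × Before d z j
amid⇒before fwd i<j (inj₁ (i<z , z<j)) = i<z , z<j
amid⇒before fwd i<j (inj₂ (j<z , z<i)) = contradiction i<j (<-asym (<-trans j<z z<i))
amid⇒before bwd j<i (inj₁ (i<z , z<j)) = contradiction j<i (<-asym (<-trans i<z z<j))
amid⇒before bwd j<i (inj₂ (j<z , z<i)) = z<i , j<z

before-wellFounded : ∀ {n} d → WellFounded (Before {n} d)
before-wellFounded fwd = Fin.<-wellFounded
before-wellFounded bwd = Fin.>-wellFounded

-- Descent along `Before d`, which is well founded in both directions by finiteness. For `bwd` the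
-- result is the largest position, that is, the nearest one when looking left.
minimal : ∀ {n} d {Q : Pred (Fin n) 0ℓ} → Decidable Q → ∃[ k ] Q k →
          ∃[ z ] (Q z × ∀ k → Before d k z → ¬ Q k)
minimal d {Q} Q? (k , q) = go k q (before-wellFounded d k)
  where
  go : ∀ k → Q k → Acc (Before d) k → ∃[ z ] (Q z × ∀ k → Before d k z → ¬ Q k)
  go k q (acc rec) with Fin.any? (λ k′ → before? d k′ k ×-dec Q? k′)
  ... | yes (k′ , k′<k , q′) = go k′ q′ (rec k′<k)
  ... | no none = k , q , λ k′ k′<k q′ → none (k′ , k′<k , q′)

-- Occurrences of a letter between two positions

module _ {A : Set} (_≟_ : DecidableEquality A) where

  Occurs : A → (w : Word A) → Pos w → Pos w → Pos w → Set
  Occurs a w i j k = Amid i j k × lookup w k ≡ a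

  occurs? : ∀ a w i j → Decidable (Occurs a w i j)
  occurs? a w i j k = amid? i j k ×-dec (lookup w k ≟ a)

  count : A → (w : Word A) → Pos w → Pos w → ℕ
  count a w i j = card (occurs? a w i j)

  count-none : ∀ {a} w {i j} → (∀ k → Amid i j k → ¬ lookup w k ≡ a) → count a w i j ≡ 0
  count-none w none = card-none (occurs? _ w _ _) λ k (p , q) → none k p q

  count-same : ∀ {a} w {i} → count a w i i ≡ 0
  count-same w = count-none w λ k p → contradiction p amid-same

  count-some : ∀ w {i j k} → Amid i j k → 0 < count (lookup w k) w i j
  count-some w {k = k} p = card-some (occurs? _ w _ _) k (p , refl)

  count-sym : ∀ a w i j → count a w i j ≡ count a w j i
  count-sym a w i j = card-cong (occurs? a w i j) (occurs? a w j i)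
    (λ (p , eq) → swap p , eq) (λ (p , eq) → swap p , eq)

  -- Both intervals are open, so the letter at `z` itself is counted by neither; the indicator makes
  -- up for it.
  count-split : ∀ a w {i j z} → Amid i j z →
                count a w i j ≡ count a w i z + (indicator (lookup w z ≟ a) + count a w z j)
  count-split a w {i} {j} {z} p = trans
    (card-⊎ (occurs? a w i j) (occurs? a w i z) rest?
      (λ {k} (q , eq) → [ (λ r → inj₁ (r , eq))
                        , [ (λ r → inj₂ (inj₁ (r , eq))) , (λ r → inj₂ (inj₂ (r , eq))) ] ]
                        (amid-split p k q))
      (λ (q , eq) → amid-left p q , eq)
      [ (λ { (refl , eq) → p , eq }) , (λ (q , eq) → amid-right p q , eq) ]
      (λ { (q , _) (inj₁ (refl , _)) → amid-irrefl q
         ; (q , _) (inj₂ (r , _)) → amid-disjoint p q r }))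
    (cong (count a w i z +_) (trans
      (card-⊎ rest? at-z? (occurs? a w z j) id inj₁ inj₂
        (λ { (refl , _) (q , _) → amid-irrefl (swap q) }))
      (cong (_+ count a w z j) card-at-z)))
    where
    at-z? : Decidable λ k → k ≡ z × lookup w k ≡ a
    at-z? k = (k Fin.≟ z) ×-dec (lookup w k ≟ a)
    rest? : Decidable λ k → (k ≡ z × lookup w k ≡ a) ⊎ Occurs a w z j k
    rest? k = at-z? k ⊎-dec occurs? a w z j k
    card-at-z : card at-z? ≡ indicator (lookup w z ≟ a)
    card-at-z with lookup w z ≟ a
    ... | yes eq = card-unique at-z? z (refl , eq) λ k → proj₁
    ... | no  ne = card-none at-z? λ { k (refl , eq) → ne eq }

  -- `count` is symmetric in its endpoints and `AtLeast` is not, so the order has to remain as a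
  -- separate conjunct.
  atLeast⇔count : ∀ {a n} w {i j} → AtLeast a n w i j ⇔ (i Fin.< j × n ≤ count a w i j)
  atLeast⇔count {a} {n} w {i} {j} = mk⇔
    (λ (i<j , S , n≤S , S⊆) → i<j , ≤-trans n≤S (∣S∣≤card (occurs? a w i j) S λ k k∈S →
      let i<k , k<j , eq = S⊆ k k∈S in inj₁ (i<k , k<j) , eq))
    (λ (i<j , n≤) → i<j , tabulate (does ∘ occurs? a w i j)
      , ≤-trans n≤ (≤-reflexive (sym (∣tabulate∣≡card (occurs? a w i j))))
      , λ k k∈ → let p , eq = ∈tabulate⁻ (occurs? a w i j) k k∈
                     i<k , k<j = amid⇒before fwd i<j p in i<k , k<j , eq)

-- Temporal formulas

-- Unary properties of positions; having no variables, they can be read at either variable.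
data TL (A : Set) : Set where
  ⊥ₜ        : TL A
  letter    : A → TL A
  neg       : TL A → TL A
  _∧_ _∨_   : TL A → TL A → TL A
  next      : Dir → (A → Bool) → TL A → TL A

Avoids : (A → Bool) → (w : Word A) → Pos w → Pos w → Set
Avoids B w i j = ∀ k → Amid i j k → ¬ T (B (lookup w k))

-- `next` is a strict until, in both directions, whose condition on the positions in between is a
-- set of forbidden letters. Such a condition is a Boolean combination of between predicates; an
-- arbitrary one would in general call for a third variable.
⟦_⟧ : TL A → (w : Word A) → Pos w → Set
⟦ ⊥ₜ ⟧         w i = T false
⟦ letter a ⟧   w i = lookup w i ≡ a
⟦ neg φ ⟧      w i = ¬ ⟦ φ ⟧ w i
⟦ φ ∧ ψ ⟧      w i = ⟦ φ ⟧ w i × ⟦ ψ ⟧ w i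
⟦ φ ∨ ψ ⟧      w i = ⟦ φ ⟧ w i ⊎ ⟦ ψ ⟧ w i
⟦ next d B φ ⟧ w i = ∃[ j ] (Before d i j × Avoids B w i j × ⟦ φ ⟧ w j)

⋁ : List X → (X → TL A) → TL A
⋁ xs f = foldr (λ x → f x ∨_) ⊥ₜ xs

⋁⁺ : ∀ (f : X → TL A) {w i x xs} → x ∈ xs → ⟦ f x ⟧ w i → ⟦ ⋁ xs f ⟧ w i
⋁⁺ f (here refl) s = inj₁ s
⋁⁺ f (there x∈)  s = inj₂ (⋁⁺ f x∈ s)

⋁⁻ : ∀ (f : X → TL A) {w i} xs → ⟦ ⋁ xs f ⟧ w i → ∃[ x ] (x ∈ xs × ⟦ f x ⟧ w i)
⋁⁻ f (x ∷ xs) (inj₁ s) = x , here refl , s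
⋁⁻ f (x ∷ xs) (inj₂ s) = let y , y∈ , s′ = ⋁⁻ f xs s in y , there y∈ , s′

guard : ∀ {P : Set} → Dec P → TL A → TL A
guard P? φ = if does P? then φ else ⊥ₜ

guard⁺ : ∀ {P : Set} (P? : Dec P) {φ : TL A} {w i} → P → ⟦ φ ⟧ w i → ⟦ guard P? φ ⟧ w i
guard⁺ (yes _) p s = s
guard⁺ (no ¬p) p s = contradiction p ¬p

guard⁻ : ∀ {P : Set} (P? : Dec P) {φ : TL A} {w i} → ⟦ guard P? φ ⟧ w i → P × ⟦ φ ⟧ w i
guard⁻ (yes p) s = p , s

-- Reaching a position under bounds on the letter counts

Cmp : ∀ {n} → Maybe Dir → Fin n → Fin n → Set
Cmp nothing  i j = i ≡ j
Cmp (just d) i j = Before d i j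

cmp? : ∀ {n} o (i j : Fin n) → Dec (Cmp o i j)
cmp? nothing  i j = i Fin.≟ j
cmp? (just d) i j = before? d i j

-- The quantitative part of a binary type: a lower bound for every letter,
-- which is attained when the letter is bounded.
record Bounds (A : Set) : Set where
  field
    need    : A → ℕ
    bounded : A → Bool

open Bounds

unconstrained : Bounds A
unconstrained = record { need = λ _ → 0 ; bounded = λ _ → false }

Complete : List A → Set
Complete letters = ∀ a → a ∈ letters

module Reachability {A : Set} (_≟_ : DecidableEquality A)
                    (letters : List A) (complete : Complete letters) where

  -- Decidability is what allows trees over these properties to be evaluated to Booleans.
  ⟦_⟧? : ∀ φ (w : Word A) → Decidable (⟦ φ ⟧ w)
  ⟦ ⊥ₜ ⟧?         w i = T? false
  ⟦ letter a ⟧?   w i = lookup w i ≟ a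
  ⟦ neg φ ⟧?      w i = ¬? (⟦ φ ⟧? w i)
  ⟦ φ ∧ ψ ⟧?      w i = ⟦ φ ⟧? w i ×-dec ⟦ ψ ⟧? w i
  ⟦ φ ∨ ψ ⟧?      w i = ⟦ φ ⟧? w i ⊎-dec ⟦ ψ ⟧? w i
  ⟦ next d B φ ⟧? w i = Fin.any? λ j →
    before? d i j ×-dec Fin.all? (λ k → amid? i j k →-dec ¬? (T? (B (lookup w k)))) ×-dec ⟦ φ ⟧? w j

  #[_] : A → (w : Word A) → Pos w → Pos w → ℕ
  #[_] = count _≟_

  Holds : Bounds A → (w : Word A) → Pos w → Pos w → Set
  Holds c w i j = ∀ a → need c a ≤ #[ a ] w i j × (T (bounded c a) → #[ a ] w i j ≤ need c a)

  Reaches : Maybe Dir → Bounds A → TL A → (w : Word A) → Pos w → Pos w → Set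
  Reaches o c β w i j = Cmp o i j × Holds c w i j × ⟦ β ⟧ w j

  Free : Bounds A → Set
  Free c = All.All (λ a → need c a ≡ 0) letters

  free? : ∀ c → Dec (Free c)
  free? c = All.all? (λ a → need c a ℕ.≟ 0) letters

  free⇒need≡0 : ∀ {c} → Free c → ∀ a → need c a ≡ 0
  free⇒need≡0 free a = All.lookup free (complete a)

  avoids⇒count≡0 : ∀ {B} w {i j b} → T (B b) → Avoids B w i j → #[ b ] w i j ≡ 0
  avoids⇒count≡0 w Bb avoids = count-none _≟_ w λ { k p refl → avoids k p Bb }

  consume : Bounds A → A → Bounds A
  consume c a = record c { need = λ b → need c b ∸ indicator (a ≟ b) }

  -- Every stop lowers this number, so it bounds the length of a walk and serves as its fuel.
  size : Bounds A → ℕ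
  size c = sum (map (need c) letters)

  sum-mono : ∀ {f g : A → ℕ} → (∀ b → f b ≤ g b) → ∀ bs → sum (map f bs) ≤ sum (map g bs)
  sum-mono f≤g []       = z≤n
  sum-mono f≤g (b ∷ bs) = +-mono-≤ (f≤g b) (sum-mono f≤g bs)

  sum-mono-< : ∀ {f g : A → ℕ} {a bs} → (∀ b → f b ≤ g b) → f a < g a → a ∈ bs →
               sum (map f bs) < sum (map g bs)
  sum-mono-< f≤g lt (here {xs = bs} refl) = +-mono-<-≤ lt (sum-mono f≤g bs)
  sum-mono-< f≤g lt (there {x = b} a∈)    = +-mono-≤-< (f≤g b) (sum-mono-< f≤g lt a∈)

  size-consume : ∀ c {a} → 0 < need c a → size (consume c a) < size c
  size-consume c {a} pos = sum-mono-< (λ b → m∸n≤m (need c b) (indicator (a ≟ b))) strict (complete a)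
    where
    strict : need c a ∸ indicator (a ≟ a) < need c a
    strict = ≤-trans (≤-reflexive (cong (λ m → suc (need c a ∸ m)) (indicator-yes (a ≟ a) refl)))
                     (∸-monoʳ-< {n = 1} (s≤s z≤n) pos)

  stop : Dir → Bounds A → TL A → TL A
  stop d c β = guard (free? c) (next d (bounded c) β)

  -- Guess the first position carrying a letter still needed. The needed letters are
  -- absent before it, so avoiding the bounded ones keeps every count exact.
  walk : ℕ → Dir → Bounds A → TL A → TL A
  walk zero    d c β = stop d c β
  walk (suc f) d c β = stop d c β ∨ ⋁ letters λ a →
    guard (0 <? need c a) (next d (bounded c) (letter a ∧ walk f d (consume c a) β))

  stop-sound : ∀ {d c β w i} → ⟦ stop d c β ⟧ w i → ∃[ j ] Reaches (just d) c β w i j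
  stop-sound {c = c} {w = w} s with guard⁻ (free? c) s
  ... | free , j , i<j , avoids , sβ = j , i<j , holds , sβ
    where
    holds : Holds c w _ j
    holds a rewrite free⇒need≡0 {c} free a = z≤n , λ b → ≤-reflexive (avoids⇒count≡0 w b avoids)

  -- A bounded letter is absent from the gap before `z`, so its count is that of the rest plus
  -- possibly one at `z`. Any other letter may occur in the gap, which only raises a count that has
  -- no upper bound.
  holds-extend : ∀ c w {i j z} → Amid i j z → 0 < need c (lookup w z) → Avoids (bounded c) w i z →
                 Holds (consume c (lookup w z)) w z j → Holds c w i j
  holds-extend c w {i} {j} {z} p pos avoids h b = lower , upper
    where
    open ≤-Reasoning
    here? : ℕ
    here? = indicator (lookup w z ≟ b)
    -- Ensures that the subtraction in `consume` is not truncated, so that adding the letter at `z`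
    -- back does not exceed the upper bound.
    here≤need : here? ≤ need c b
    here≤need with lookup w z ≟ b
    ... | yes refl = pos
    ... | no _     = z≤n
    lower : need c b ≤ #[ b ] w i j
    lower = begin
      need c b                                ≤⟨ m≤n+m∸n (need c b) here? ⟩
      here? + (need c b ∸ here?)              ≤⟨ +-monoʳ-≤ here? (proj₁ (h b)) ⟩
      here? + #[ b ] w z j                    ≤⟨ m≤n+m _ (#[ b ] w i z) ⟩
      #[ b ] w i z + (here? + #[ b ] w z j)   ≡⟨ count-split _≟_ b w p ⟨
      #[ b ] w i j                            ∎
    upper : T (bounded c b) → #[ b ] w i j ≤ need c b
    upper bd = begin
      #[ b ] w i j                            ≡⟨ count-split _≟_ b w p ⟩
      #[ b ] w i z + (here? + #[ b ] w z j)   ≡⟨ cong (_+ _) (avoids⇒count≡0 w bd avoids) ⟩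
      here? + #[ b ] w z j                    ≤⟨ +-monoʳ-≤ here? (proj₂ (h b) bd) ⟩
      here? + (need c b ∸ here?)              ≡⟨ m+[n∸m]≡n here≤need ⟩
      need c b                                ∎

  walk-sound : ∀ f {d c β w i} → ⟦ walk f d c β ⟧ w i → ∃[ j ] Reaches (just d) c β w i j
  walk-sound zero    s        = stop-sound s
  walk-sound (suc f) (inj₁ s) = stop-sound s
  walk-sound (suc f) {d} {c} {β} {w} (inj₂ s) with ⋁⁻ _ letters s
  ... | a , _ , s′ with guard⁻ (0 <? need c a) s′
  ...   | pos , z , i<z , avoids , refl , s″ with walk-sound f s″
  ...     | j , z<j , h , sβ = let i<j , p = before⇒amid d i<z z<j in
              j , i<j , holds-extend c w p pos avoids h , sβ

  -- A letter with positive need does not occur in the gap, so all its occurrences lie at `z` or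
  -- beyond; for need zero the lower bound is void. Upper bounds survive because dropping the gap
  -- can only lower a count.
  holds-consume : ∀ c w {i j z} → Amid i j z → (∀ k → Amid i z k → need c (lookup w k) ≡ 0) →
                  Holds c w i j → Holds (consume c (lookup w z)) w z j
  holds-consume c w {i} {j} {z} p unneeded h b = m≤n+o⇒m∸n≤o (need c b) here? lower , upper
    where
    open ≤-Reasoning
    here? : ℕ
    here? = indicator (lookup w z ≟ b)
    lower : need c b ≤ here? + #[ b ] w z j
    lower with need c b in eq
    ... | zero  = z≤n
    ... | suc n = begin
      suc n                                   ≡⟨ eq ⟨
      need c b                                ≤⟨ proj₁ (h b) ⟩
      #[ b ] w i j                            ≡⟨ count-split _≟_ b w p ⟩
      #[ b ] w i z + (here? + #[ b ] w z j)   ≡⟨ cong (_+ _) (count-none _≟_ w λ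
                                                   { k q refl → 1+n≢0 (trans (sym eq) (unneeded k q)) }) ⟩
      here? + #[ b ] w z j                    ∎
    upper : T (bounded c b) → #[ b ] w z j ≤ need c b ∸ here?
    upper bd = m+n≤o⇒m≤o∸n _ (begin
      #[ b ] w z j + here?                    ≡⟨ +-comm _ here? ⟩
      here? + #[ b ] w z j                    ≤⟨ m≤n+m _ (#[ b ] w i z) ⟩
      #[ b ] w i z + (here? + #[ b ] w z j)   ≡⟨ count-split _≟_ b w p ⟨
      #[ b ] w i j                            ≤⟨ proj₂ (h b) bd ⟩
      need c b                                ∎)

  -- A bounded letter of need zero has count zero, so it cannot occur in the gap. The disjunction
  -- covers both a gap before a stop and the last one, which ends at the target.
  unneeded⇒avoids : ∀ c w {i j z} → Amid i j z ⊎ j ≡ z → Holds c w i j →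
                    (∀ k → Amid i z k → need c (lookup w k) ≡ 0) → Avoids (bounded c) w i z
  unneeded⇒avoids c w p h unneeded k q bd = <-irrefl refl
    (<-≤-trans (count-some _≟_ w (amid p q)) (≤-trans (proj₂ (h (lookup w k)) bd) (≤-reflexive (unneeded k q))))
    where
    amid : ∀ {i j z k} → Amid i j z ⊎ j ≡ z → Amid i z k → Amid i j k
    amid (inj₁ p)    q = amid-left p q
    amid (inj₂ refl) q = q

  walk-stop : ∀ f {d c β w i} → ⟦ stop d c β ⟧ w i → ⟦ walk f d c β ⟧ w i
  walk-stop zero    s = s
  walk-stop (suc f) s = inj₁ s

  -- Stop at the needed letter nearest to `i`. If there is none before `j`, then all needs are zero,
  -- since a positive need would force an occurrence.
  walk-complete : ∀ f {d c β w i j} → size c ≤ f → Reaches (just d) c β w i j → ⟦ walk f d c β ⟧ w i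
  walk-complete f {d} {c} {β} {w} {i} {j} size≤f (i<j , h , sβ)
    with Fin.any? (λ k → amid? i j k ×-dec (0 <? need c (lookup w k)))
  ... | no none = walk-stop f (guard⁺ (free? c) (All.tabulate λ {a} _ → free a)
                    (j , i<j , unneeded⇒avoids c w (inj₂ refl) h unneeded , sβ))
    where
    unneeded : ∀ k → Amid i j k → need c (lookup w k) ≡ 0
    unneeded k q = n≤0⇒n≡0 (≮⇒≥ λ pos → none (k , q , pos))
    free : ∀ a → need c a ≡ 0
    free a with need c a in eq
    ... | zero  = refl
    ... | suc n = contradiction
      (subst (0 <_) (count-none _≟_ w λ { k q refl → 1+n≢0 (trans (sym eq) (unneeded k q)) })
                    (≤-trans (s≤s z≤n) (≤-trans (≤-reflexive (sym eq)) (proj₁ (h a))))) λ ()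
  ... | yes some with minimal d (λ k → amid? i j k ×-dec (0 <? need c (lookup w k))) some
  ...   | z , (p , pos) , first = step f (≤-trans (size-consume c pos) size≤f)
    where
    unneeded : ∀ k → Amid i z k → need c (lookup w k) ≡ 0
    unneeded k q = n≤0⇒n≡0 (≮⇒≥ λ pos′ →
      first k (proj₂ (amid⇒before d (proj₁ (amid⇒before d i<j p)) q)) (amid-left p q , pos′))
    -- The fuel is split only here, where the strict decrease of `size` excludes zero.
    step : ∀ f → size (consume c (lookup w z)) < f → ⟦ walk f d c β ⟧ w i
    step (suc f′) (s≤s size′≤f) = inj₂ (⋁⁺ _ (complete (lookup w z)) (guard⁺ (0 <? need c (lookup w z)) pos
      (z , proj₁ (amid⇒before d i<j p) , unneeded⇒avoids c w (inj₁ p) h unneeded , refl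
         , walk-complete f′ {c = consume c (lookup w z)} {β} size′≤f
             (proj₂ (amid⇒before d i<j p) , holds-consume c w p unneeded h , sβ))))

  -- Nothing lies between a position and itself, so for equal positions the needs must vanish and
  -- the upper bounds are automatic.
  reach : Maybe Dir → Bounds A → TL A → TL A
  reach nothing  c β = guard (free? c) β
  reach (just d) c β = walk (size c) d c β

  reach-sound : ∀ o {c β w i} → ⟦ reach o c β ⟧ w i → ∃[ j ] Reaches o c β w i j
  reach-sound nothing {c} {w = w} {i} s with guard⁻ (free? c) s
  ... | free , sβ = i , refl , holds , sβ
    where
    holds : Holds c w i i
    holds a rewrite free⇒need≡0 {c} free a = z≤n , λ _ → ≤-reflexive (count-same _≟_ w)
  reach-sound (just d) {c} {β} s = walk-sound (size c) {c = c} {β} s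

  reach-complete : ∀ o {c β w i j} → Reaches o c β w i j → ⟦ reach o c β ⟧ w i
  reach-complete nothing {c} {w = w} (refl , h , sβ) = guard⁺ (free? c) (All.tabulate λ {a} _ →
    n≤0⇒n≡0 (≤-trans (proj₁ (h a)) (≤-reflexive (count-same _≟_ w)))) sβ
  reach-complete (just d) {c} {β} r = walk-complete (size c) {c = c} {β} ≤-refl r

-- Orders of two positions and valuations of two variables

reverse : Dir → Dir
reverse fwd = bwd
reverse bwd = fwd

_≟ᵒ_ : DecidableEquality (Maybe Dir)
_≟ᵒ_ = Maybe.≡-dec _≟ᵈ_

does-true : ∀ {P : Set} (P? : Dec P) → does P? ≡ true → P
does-true (yes p) _ = p

does-false : ∀ {P : Set} (P? : Dec P) → does P? ≡ false → ¬ P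
does-false (no ¬p) _ = ¬p

cmp-reverse : ∀ {n} o {i j : Fin n} → Cmp (Maybe.map reverse o) i j ⇔ Cmp o j i
cmp-reverse nothing    = mk⇔ sym sym
cmp-reverse (just fwd) = mk⇔ id id
cmp-reverse (just bwd) = mk⇔ id id

cmp-total : ∀ {n} (i j : Fin n) → ∃[ o ] Cmp o i j
cmp-total i j with Fin.<-cmp i j
... | tri< i<j _ _ = just fwd , i<j
... | tri≈ _ i≡j _ = nothing , i≡j
... | tri> _ _ j<i = just bwd , j<i

cmp-unique : ∀ {n} o o′ {i j : Fin n} → Cmp o i j → Cmp o′ i j → o ≡ o′
cmp-unique nothing    nothing    _    _ = refl
cmp-unique nothing    (just fwd) refl q = contradiction q (<-irrefl refl)
cmp-unique nothing    (just bwd) refl q = contradiction q (<-irrefl refl)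
cmp-unique (just fwd) nothing    p refl = contradiction p (<-irrefl refl)
cmp-unique (just fwd) (just fwd) _    _ = refl
cmp-unique (just fwd) (just bwd) p    q = contradiction p (<-asym q)
cmp-unique (just bwd) nothing    p refl = contradiction p (<-irrefl refl)
cmp-unique (just bwd) (just fwd) p    q = contradiction p (<-asym q)
cmp-unique (just bwd) (just bwd) _    _ = refl

orders : List (Maybe Dir)
orders = nothing ∷ just fwd ∷ just bwd ∷ []

∈-orders : ∀ o → o ∈ orders
∈-orders nothing    = here refl
∈-orders (just fwd) = there (here refl)
∈-orders (just bwd) = there (there (here refl))

-- Unlike in `Env`, both variables always have a value, which spares atoms their scope proofs. The
-- price is that the empty word has no valuation and is treated apart.
Valuation : ℕ → Set
Valuation n = Var → Fin n

other : Var → Var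
other zero       = suc zero
other (suc zero) = zero

_⟨_≔_⟩ : ∀ {n} → Valuation n → Var → Fin n → Valuation n
(e ⟨ zero ≔ j ⟩)     zero       = j
(e ⟨ zero ≔ j ⟩)     (suc zero) = e (suc zero)
(e ⟨ suc zero ≔ j ⟩) zero       = e zero
(e ⟨ suc zero ≔ j ⟩) (suc zero) = j

≔-same : ∀ {n} (e : Valuation n) v {j} → (e ⟨ v ≔ j ⟩) v ≡ j
≔-same e zero       = refl
≔-same e (suc zero) = refl

≔-old : ∀ {n} (e : Valuation n) {u v j} → u ≢ v → (e ⟨ v ≔ j ⟩) u ≡ e u
≔-old e {zero}     {zero}     u≢v = contradiction refl u≢v
≔-old e {zero}     {suc zero} u≢v = refl
≔-old e {suc zero} {zero}     u≢v = refl
≔-old e {suc zero} {suc zero} u≢v = contradiction refl u≢v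

≢⇒≡other : ∀ {u v : Var} → u ≢ v → u ≡ other v
≢⇒≡other {zero}     {zero}     u≢v = contradiction refl u≢v
≢⇒≡other {zero}     {suc zero} u≢v = refl
≢⇒≡other {suc zero} {zero}     u≢v = refl
≢⇒≡other {suc zero} {suc zero} u≢v = contradiction refl u≢v

≔-other : ∀ {n} (e : Valuation n) {u v j} → u ≢ v → (e ⟨ v ≔ j ⟩) u ≡ e (other v)
≔-other e u≢v = trans (≔-old e u≢v) (cong e (≢⇒≡other u≢v))

-- Decision trees over atoms

-- Counts are symmetric in the two positions, so `many` need not mention the variables.
data Atom (A : Set) : Set where
  unary : Var → TL A → Atom A
  order : Maybe Dir → Atom A
  many  : A → ℕ → Atom A

-- Each branch is a conjunction of literals and the branches exclude one another, so an existential
-- quantifier is handled branch by branch. Negation, conjunction and disjunction are all instances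
-- of `graft`.
data Tree (A : Set) : Set where
  leaf : Bool → Tree A
  node : Atom A → Tree A → Tree A → Tree A

graft : Tree A → Tree A → Tree A → Tree A
graft (leaf b)     s s′ = if b then s else s′
graft (node a t f) s s′ = node a (graft t s s′) (graft f s s′)

atom : Atom A → Tree A
atom a = node a (leaf true) (leaf false)

-- The order of the two variables if v is at o from the other variable.
orient : Var → Maybe Dir → Maybe Dir
orient zero       o = Maybe.map reverse o
orient (suc zero) o = o

cmp-orient : ∀ {n} v o (e : Valuation n) {j} → Cmp o (e (other v)) j →
             Cmp (orient v o) ((e ⟨ v ≔ j ⟩) zero) ((e ⟨ v ≔ j ⟩) (suc zero))
cmp-orient zero       o e p = from (cmp-reverse o) p
cmp-orient (suc zero) o e p = p

-- Eliminating a quantifier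

module Elimination {A : Set} (_≟_ : DecidableEquality A)
                   (letters : List A) (complete : Complete letters) where

  open Reachability _≟_ letters complete

  ⟦_⟧ᵃ : Atom A → (w : Word A) → Valuation _ → Set
  ⟦ unary u φ ⟧ᵃ w e = ⟦ φ ⟧ w (e u)
  ⟦ order o ⟧ᵃ   w e = Cmp o (e zero) (e (suc zero))
  ⟦ many a k ⟧ᵃ  w e = k ≤ #[ a ] w (e zero) (e (suc zero))

  ⟦_⟧ᵃ? : ∀ a w e → Dec (⟦ a ⟧ᵃ w e)
  ⟦ unary u φ ⟧ᵃ? w e = ⟦ φ ⟧? w (e u)
  ⟦ order o ⟧ᵃ?   w e = cmp? o (e zero) (e (suc zero))
  ⟦ many a k ⟧ᵃ?  w e = k ≤? #[ a ] w (e zero) (e (suc zero))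

  eval : Tree A → (w : Word A) → Valuation _ → Bool
  eval (leaf b)     w e = b
  eval (node a t f) w e = if does (⟦ a ⟧ᵃ? w e) then eval t w e else eval f w e

  eval-graft : ∀ t s s′ w e → eval (graft t s s′) w e ≡ (if eval t w e then eval s w e else eval s′ w e)
  eval-graft (leaf true)  s s′ w e = refl
  eval-graft (leaf false) s s′ w e = refl
  eval-graft (node a t f) s s′ w e with does (⟦ a ⟧ᵃ? w e)
  ... | true  = eval-graft t s s′ w e
  ... | false = eval-graft f s s′ w e

  infixl 6 _[_≔_]
  _[_≔_] : (A → X) → A → X → A → X
  (g [ a ≔ x ]) b = if does (b ≟ a) then x else g b

  exactly : Bounds A → A → ℕ → Bounds A
  exactly c a m = record { need = need c [ a ≔ m ] ; bounded = bounded c [ a ≔ true ] }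

  -- The Boolean tells whether there are at least k letters a in the respective case.
  split : Bounds A → A → ℕ → List (Bounds A × Bool)
  split c a k =
    if bounded c a
    then (c , does (k ≤? need c a)) ∷ []
    else (record c { need = need c [ a ≔ need c a ⊔ k ] } , true)
         ∷ applyUpTo (λ m → exactly c a (need c a + m) , false) (k ∸ need c a)

  Refines : Bounds A → A → ℕ → Bounds A × Bool → (w : Word A) → Pos w → Pos w → Set
  Refines c a k (c′ , b) w i j = Holds c w i j × does (k ≤? #[ a ] w i j) ≡ b

  -- If `a` is bounded, its count equals its need and the comparison with `k` is settled. Otherwise
  -- `c` has no upper bound for `a`, and each refinement only raises the lower one.
  split-sound : ∀ c a k w i j {c′ b} → (c′ , b) ∈ split c a k → Holds c′ w i j → Refines c a k (c′ , b) w i j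
  split-sound c a k w i j p h with bounded c a in eq
  split-sound c a k w i j (here refl) h | true = h , cong (λ m → does (k ≤? m)) count≡need
    where
    count≡need : #[ a ] w i j ≡ need c a
    count≡need = ≤-antisym (proj₂ (h a) (subst T (sym eq) _)) (proj₁ (h a))
  split-sound c a k w i j (here refl) h | false = holds , dec-true (_ ≤? _) (≤-trans (m≤n⊔m (need c a) k) at-a)
    where
    at-a : need c a ⊔ k ≤ #[ a ] w i j
    at-a with a ≟ a | h a
    ... | yes _  | le , _ = le
    ... | no a≢a | _      = contradiction refl a≢a
    holds : Holds c w i j
    holds b with b ≟ a | h b
    ... | yes refl | le , _ = ≤-trans (m≤m⊔n (need c a) k) le , λ bd → contradiction (subst T eq bd) λ ()
    ... | no _     | hb     = hb
  split-sound c a k w i j (there p) h | false with ∈-applyUpTo⁻ (λ m → exactly c a (need c a + m) , false) p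
  ... | m , m<k∸n , refl = holds , dec-false (_ ≤? _) λ k≤ →
    <⇒≱ m<k∸n (m≤n+o⇒m∸n≤o k (need c a) (≤-trans k≤ at-a))
    where
    at-a : #[ a ] w i j ≤ need c a + m
    at-a with a ≟ a | h a
    ... | yes _  | _ , ge = ge _
    ... | no a≢a | _      = contradiction refl a≢a
    holds : Holds c w i j
    holds b with b ≟ a | h b
    ... | yes refl | le , _ = ≤-trans (m≤m+n (need c a) m) le , λ bd → contradiction (subst T eq bd) λ ()
    ... | no _     | hb     = hb

  -- A count below `k` that respects the lower bound is one of the finitely many values from
  -- `need c a` to `k - 1`, each of which `split` lists as an exact count.
  split-complete : ∀ c a k w i j → Holds c w i j → ∃[ c′ ] ∃[ b ] ((c′ , b) ∈ split c a k × Holds c′ w i j)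
  split-complete c a k w i j h with bounded c a in eq
  ... | true = c , _ , here refl , h
  ... | false with k ≤? #[ a ] w i j
  ...   | yes k≤ = _ , _ , here refl , holds
    where
    holds : Holds (record c { need = need c [ a ≔ need c a ⊔ k ] }) w i j
    holds b with b ≟ a
    ... | yes refl = ⊔-lub (proj₁ (h a)) k≤ , λ bd → contradiction (subst T eq bd) λ ()
    ... | no _     = h b
  ...   | no k≰ = _ , _ , there (∈-applyUpTo⁺ (λ m → exactly c a (need c a + m) , false)
                            (∸-monoˡ-< (≰⇒> k≰) (proj₁ (h a)))) , holds
    where
    n+[m∸n]≡m : need c a + (#[ a ] w i j ∸ need c a) ≡ #[ a ] w i j
    n+[m∸n]≡m = m+[n∸m]≡n (proj₁ (h a))
    holds : Holds (exactly c a (need c a + (#[ a ] w i j ∸ need c a))) w i j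
    holds b with b ≟ a
    ... | yes refl = ≤-reflexive n+[m∸n]≡m , λ _ → ≤-reflexive (sym n+[m∸n]≡m)
    ... | no _     = h b

  -- elim v o c β t says of the position of the other variable that some position for v,
  -- at o from it, satisfies c, β and t; c and β collect the literals along a branch of t.
  elim : Var → Maybe Dir → Bounds A → TL A → Tree A → TL A
  elim v o c β (leaf b) = guard (T? b) (reach o c β)
  elim v o c β (node (unary u φ) t f) =
    if does (u Fin.≟ v)
    then elim v o c (β ∧ φ) t ∨ elim v o c (β ∧ neg φ) f
    else (φ ∧ elim v o c β t) ∨ (neg φ ∧ elim v o c β f)
  elim v o c β (node (order o′) t f) =
    if does (o′ ≟ᵒ orient v o) then elim v o c β t else elim v o c β f
  elim v o c β (node (many a k) t f) =
    ⋁ (split c a k) λ (c′ , b) → if b then elim v o c′ β t else elim v o c′ β f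

  Eliminates : Var → Maybe Dir → Bounds A → TL A → Tree A → (w : Word A) → Valuation _ → Pos w → Set
  Eliminates v o c β t w e j = Reaches o c β w (e (other v)) j × T (eval t w (e ⟨ v ≔ j ⟩))

  node⁺-yes : ∀ {a t f w e} → ⟦ a ⟧ᵃ w e → T (eval t w e) → T (eval (node a t f) w e)
  node⁺-yes {a} {w = w} {e} p s with ⟦ a ⟧ᵃ? w e
  ... | yes _ = s
  ... | no ¬p = contradiction p ¬p

  node⁺-no : ∀ {a t f w e} → ¬ ⟦ a ⟧ᵃ w e → T (eval f w e) → T (eval (node a t f) w e)
  node⁺-no {a} {w = w} {e} ¬p s with ⟦ a ⟧ᵃ? w e
  ... | yes p = contradiction p ¬p
  ... | no _  = s

  node⁻ : ∀ {a t f w e} → T (eval (node a t f) w e) →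
          (⟦ a ⟧ᵃ w e × T (eval t w e)) ⊎ (¬ ⟦ a ⟧ᵃ w e × T (eval f w e))
  node⁻ {a} {w = w} {e} s with ⟦ a ⟧ᵃ? w e
  ... | yes p = inj₁ (p , s)
  ... | no ¬p = inj₂ (¬p , s)

  count-oriented : ∀ a w (e : Valuation _) v {j} →
    #[ a ] w ((e ⟨ v ≔ j ⟩) zero) ((e ⟨ v ≔ j ⟩) (suc zero)) ≡ #[ a ] w (e (other v)) j
  count-oriented a w e zero       = count-sym _≟_ a w _ _
  count-oriented a w e (suc zero) = refl

  -- Each literal is checked where it can be: on `v` at the target, through `β`; on the other
  -- variable on the spot; an order atom by comparison with `o`; a count through `c`.
  elim-sound : ∀ v o c β t {w} (e : Valuation _) → ⟦ elim v o c β t ⟧ w (e (other v)) →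
               ∃[ j ] Eliminates v o c β t w e j
  elim-sound v o c β (leaf true) e s = let j , r = reach-sound o {c} {β} s in j , r , _
  elim-sound v o c β (node (unary u φ) t f) {w} e s with u Fin.≟ v
  elim-sound v o c β (node (unary u φ) t f) {w} e (inj₁ s) | yes refl =
    let j , (p , h , sβ , sφ) , s′ = elim-sound v o c (β ∧ φ) t e s
    in j , (p , h , sβ) , node⁺-yes {unary u φ} {t} {f} (subst (⟦ φ ⟧ w) (sym (≔-same e v)) sφ) s′
  elim-sound v o c β (node (unary u φ) t f) {w} e (inj₂ s) | yes refl =
    let j , (p , h , sβ , sφ) , s′ = elim-sound v o c (β ∧ neg φ) f e s
    in j , (p , h , sβ) , node⁺-no {unary u φ} {t} {f} (subst (⟦ neg φ ⟧ w) (sym (≔-same e v)) sφ) s′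
  elim-sound v o c β (node (unary u φ) t f) {w} e (inj₁ (sφ , s)) | no u≢v =
    let j , r , s′ = elim-sound v o c β t e s
    in j , r , node⁺-yes {unary u φ} {t} {f} (subst (⟦ φ ⟧ w) (sym (≔-other e u≢v)) sφ) s′
  elim-sound v o c β (node (unary u φ) t f) {w} e (inj₂ (sφ , s)) | no u≢v =
    let j , r , s′ = elim-sound v o c β f e s
    in j , r , node⁺-no {unary u φ} {t} {f} (subst (⟦ neg φ ⟧ w) (sym (≔-other e u≢v)) sφ) s′
  elim-sound v o c β (node (order o′) t f) {w} e s with o′ ≟ᵒ orient v o
  ... | yes refl =
    let j , r , s′ = elim-sound v o c β t e s
    in j , r , node⁺-yes {order o′} {t} {f} (cmp-orient v o e (proj₁ r)) s′
  ... | no o′≢o =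
    let j , r , s′ = elim-sound v o c β f e s
    in j , r , node⁺-no {order o′} {t} {f} (λ q → o′≢o (cmp-unique _ _ q (cmp-orient v o e (proj₁ r)))) s′
  elim-sound v o c β (node (many a k) t f) {w} e s with ⋁⁻ _ (split c a k) s
  ... | (c′ , true) , c′∈ , s₁ =
    let j , (p , h , sβ) , s′ = elim-sound v o c′ β t e s₁
        h′ , eq = split-sound c a k w (e (other v)) j c′∈ h
    in j , (p , h′ , sβ) , node⁺-yes {many a k} {t} {f}
         (subst (k ≤_) (sym (count-oriented a w e v)) (does-true (k ≤? _) eq)) s′
  ... | (c′ , false) , c′∈ , s₁ =
    let j , (p , h , sβ) , s′ = elim-sound v o c′ β f e s₁
        h′ , eq = split-sound c a k w (e (other v)) j c′∈ h
    in j , (p , h′ , sβ) , node⁺-no {many a k} {t} {f}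
         (λ k≤ → does-false (k ≤? _) eq (subst (k ≤_) (count-oriented a w e v) k≤)) s′

  elim-complete : ∀ v o c β t {w} (e : Valuation _) {j} → Eliminates v o c β t w e j →
                  ⟦ elim v o c β t ⟧ w (e (other v))
  elim-complete v o c β (leaf true) e (r , _) = reach-complete o {c} {β} r
  elim-complete v o c β (node (unary u φ) t f) {w} e (r@(p , h , sβ) , s)
    with u Fin.≟ v | node⁻ {unary u φ} {t} {f} s
  ... | yes refl | inj₁ (sφ , s′) =
    inj₁ (elim-complete v o c (β ∧ φ) t e ((p , h , sβ , subst (⟦ φ ⟧ w) (≔-same e v) sφ) , s′))
  ... | yes refl | inj₂ (sφ , s′) =
    inj₂ (elim-complete v o c (β ∧ neg φ) f e ((p , h , sβ , subst (⟦ neg φ ⟧ w) (≔-same e v) sφ) , s′))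
  ... | no u≢v   | inj₁ (sφ , s′) = inj₁ (subst (⟦ φ ⟧ w) (≔-other e u≢v) sφ , elim-complete v o c β t e (r , s′))
  ... | no u≢v   | inj₂ (sφ , s′) = inj₂ (subst (⟦ neg φ ⟧ w) (≔-other e u≢v) sφ , elim-complete v o c β f e (r , s′))
  elim-complete v o c β (node (order o′) t f) {w} e (r , s)
    with o′ ≟ᵒ orient v o | node⁻ {order o′} {t} {f} s
  ... | yes refl | inj₁ (_ , s′) = elim-complete v o c β t e (r , s′)
  ... | yes refl | inj₂ (q , _)  = contradiction (cmp-orient v o e (proj₁ r)) q
  ... | no o′≢o  | inj₁ (q , _)  = contradiction (cmp-unique _ _ q (cmp-orient v o e (proj₁ r))) o′≢o
  ... | no _     | inj₂ (_ , s′) = elim-complete v o c β f e (r , s′)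
  elim-complete v o c β (node (many a k) t f) {w} e {j} ((p , h , sβ) , s)
    with split-complete c a k w (e (other v)) j h
  ... | c′ , b , c′∈ , h′ =
    ⋁⁺ _ c′∈ (branch b (proj₂ (split-sound c a k w (e (other v)) j c′∈ h′)) (node⁻ {many a k} {t} {f} s))
    where
    branch : ∀ b → does (k ≤? #[ a ] w (e (other v)) j) ≡ b →
             (⟦ many a k ⟧ᵃ w (e ⟨ v ≔ j ⟩) × T (eval t w (e ⟨ v ≔ j ⟩))) ⊎
             (¬ ⟦ many a k ⟧ᵃ w (e ⟨ v ≔ j ⟩) × T (eval f w (e ⟨ v ≔ j ⟩))) →
             ⟦ if b then elim v o c′ β t else elim v o c′ β f ⟧ w (e (other v))
    branch true  _  (inj₁ (_ , s′)) = elim-complete v o c′ β t e ((p , h′ , sβ) , s′)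
    branch true  eq (inj₂ (q , _))  =
      contradiction (subst (k ≤_) (sym (count-oriented a w e v)) (does-true (k ≤? _) eq)) q
    branch false eq (inj₁ (q , _))  = contradiction (subst (k ≤_) (count-oriented a w e v) q) (does-false (k ≤? _) eq)
    branch false _  (inj₂ (_ , s′)) = elim-complete v o c′ β f e ((p , h′ , sβ) , s′)

  connects : Var → Tree A → Maybe Dir → TL A
  connects v t o = elim v o unconstrained (neg ⊥ₜ) t

  exists : Var → Tree A → TL A
  exists v t = ⋁ orders (connects v t)

  -- Neither side depends on the value of `e` at `v`, as befits a bound variable. The three orders
  -- are exhaustive, and the initial bounds and target condition hold trivially.
  exists⇔ : ∀ v t {w} (e : Valuation _) → ⟦ exists v t ⟧ w (e (other v)) ⇔ (∃[ j ] T (eval t w (e ⟨ v ≔ j ⟩)))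
  exists⇔ v t {w} e = mk⇔
    (λ s → let o , _ , s′ = ⋁⁻ (connects v t) orders s
               j , _ , s″ = elim-sound v o unconstrained (neg ⊥ₜ) t e s′
           in j , s″)
    (λ (j , s) → let o , p = cmp-total (e (other v)) j in
      ⋁⁺ (connects v t) (∈-orders o) (elim-complete v o unconstrained (neg ⊥ₜ) t e
        ((p , (λ _ → z≤n , λ ()) , λ ()) , s)))

-- From between predicates to thresholds

∃-cong : ∀ {P Q : X → Set} → (∀ x → P x ⇔ Q x) → (∃[ x ] P x) ⇔ (∃[ x ] Q x)
∃-cong P⇔Q = mk⇔ (λ (x , p) → x , to (P⇔Q x) p) (λ (x , q) → x , from (P⇔Q x) q)

∀-cong : ∀ {P Q : X → Set} → (∀ x → P x ⇔ Q x) → (∀ x → P x) ⇔ (∀ x → Q x)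
∀-cong P⇔Q = mk⇔ (λ p x → to (P⇔Q x) (p x)) (λ q x → from (P⇔Q x) (q x))

-- The order of the endpoints, explicit in `AtLeast`, is forced by the position in between.
between⇔atLeast1 : ∀ {a : A} w {i j} → Between a w i j ⇔ AtLeast a 1 w i j
between⇔atLeast1 w = mk⇔
  (λ (k , occ@(i<k , k<j , _)) → <-trans i<k k<j , ⁅ k ⁆ , ≤-reflexive (sym (∣⁅x⁆∣≡1 k))
    , λ l l∈ → subst (OccursBetween _ w _ _) (sym (x∈⁅y⁆⇒x≡y k l∈)) occ)
  (λ (_ , S , 1≤∣S∣ , S⊆) → let k , k∈S = inhabited S 1≤∣S∣ in k , S⊆ k k∈S)
  where
  inhabited : ∀ {n} (S : Subset n) → 1 ≤ ∣ S ∣ → Subset.Nonempty S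
  inhabited {n} S 1≤∣S∣ with nonempty? S
  ... | yes ne = ne
  ... | no empty = contradiction (subst (1 ≤_) (trans (cong ∣_∣ (Empty-unique empty)) (∣⊥∣≡0 n)) 1≤∣S∣) λ ()

inv⇒th : Formula (Inv A) Γ → Formula (Th A) Γ
inv⇒th (letter a u p)  = letter a u p
inv⇒th (less u v p q)  = less u v p q
inv⇒th (equal u v p q) = equal u v p q
inv⇒th (rel a u v p q) = rel (a , 1) u v p q
inv⇒th (neg φ)         = neg (inv⇒th φ)
inv⇒th (and φ ψ)       = and (inv⇒th φ) (inv⇒th ψ)
inv⇒th (or φ ψ)        = or (inv⇒th φ) (inv⇒th ψ)
inv⇒th (all′ v φ)      = all′ v (inv⇒th φ)
inv⇒th (ex v φ)        = ex v (inv⇒th φ)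

sat-inv⇒th : ∀ (φ : Formula (Inv A) Γ) {w} (ρ : Env Γ _) → Sat w ρ φ ⇔ Sat w ρ (inv⇒th φ)
sat-inv⇒th (letter a u p)  ρ = ⇔-id _
sat-inv⇒th (less u v p q)  ρ = ⇔-id _
sat-inv⇒th (equal u v p q) ρ = ⇔-id _
sat-inv⇒th (rel a u v p q) {w} ρ = between⇔atLeast1 w
sat-inv⇒th (neg φ)         ρ = ¬-cong-⇔ (sat-inv⇒th φ ρ)
sat-inv⇒th (and φ ψ)       ρ = sat-inv⇒th φ ρ ×-⇔ sat-inv⇒th ψ ρ
sat-inv⇒th (or φ ψ)        ρ = sat-inv⇒th φ ρ ⊎-⇔ sat-inv⇒th ψ ρ
sat-inv⇒th (all′ v φ)      ρ = ∀-cong λ i → sat-inv⇒th φ (ρ [ v ↦ i ])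
sat-inv⇒th (ex v φ)        ρ = ∃-cong λ i → sat-inv⇒th φ (ρ [ v ↦ i ])

-- From thresholds to between predicates

-- Quantified over the scope proof, because an updated environment computes its own.
Assigns : ∀ {n} → Env Γ n → Var → Fin n → Set
Assigns {Γ} ρ u i = (p : u Subset.∈ Γ) → ρ u p ≡ i

assigns-new : ∀ {n} (ρ : Env Γ n) v {i} → Assigns (ρ [ v ↦ i ]) v i
assigns-new ρ v p with v Fin.≟ v
... | yes _  = refl
... | no v≢v = contradiction refl v≢v

assigns-old : ∀ {n} (ρ : Env Γ n) {u v i j} → u ≢ v → Assigns ρ u i → Assigns (ρ [ v ↦ j ]) u i
assigns-old {Γ} ρ {u} {v} u≢v ρu p with u Fin.≟ v
... | yes u≡v = contradiction u≡v u≢v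
... | no _ with x∈p∪q⁻ ⁅ v ⁆ Γ p
...   | inj₁ u∈⁅v⁆ = contradiction (x∈⁅y⁆⇒x≡y v u∈⁅v⁆) u≢v
...   | inj₂ u∈Γ   = ρu u∈Γ

≢other : ∀ v → v ≢ other v
≢other zero       ()
≢other (suc zero) ()

new∈ : ∀ v → v Subset.∈ (⁅ v ⁆ ∪ Γ)
new∈ v = x∈p∪q⁺ (inj₁ (x∈⁅x⁆ v))

old∈ : ∀ {u v} → u Subset.∈ Γ → u Subset.∈ (⁅ v ⁆ ∪ Γ)
old∈ p = x∈p∪q⁺ (inj₂ p)

module Inv⇐Th {A : Set} (_≟_ : DecidableEquality A)
              (letters : List A) (complete : Complete letters) where

  open Reachability _≟_ letters complete
  open Elimination _≟_ letters complete

  before : Dir → (u v : Var) → u Subset.∈ Γ → v Subset.∈ Γ → Formula (Inv A) Γ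
  before fwd u v p q = less u v p q
  before bwd u v p q = less v u q p

  -- Each letter appears in both orientations because `Amid` is symmetric and `Between` is not;
  -- `less u u p p` stands for falsity.
  someAmid : List A → (u v : Var) → u Subset.∈ Γ → v Subset.∈ Γ → Formula (Inv A) Γ
  someAmid []       u v p q = less u u p p
  someAmid (b ∷ bs) u v p q = or (or (rel b u v p q) (rel b v u q p)) (someAmid bs u v p q)

  tl⇒inv : TL A → (v : Var) → v Subset.∈ Γ → Formula (Inv A) Γ
  tl⇒inv ⊥ₜ           v p = less v v p p
  tl⇒inv (letter a)   v p = letter a v p
  tl⇒inv (neg φ)      v p = neg (tl⇒inv φ v p)
  tl⇒inv (φ ∧ ψ)      v p = and (tl⇒inv φ v p) (tl⇒inv ψ v p)
  tl⇒inv (φ ∨ ψ)      v p = or (tl⇒inv φ v p) (tl⇒inv ψ v p)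
  tl⇒inv (next d B φ) v p = ex u (and (before d v u (old∈ p) (new∈ u))
    (and (neg (someAmid (filter (T? ∘ B) letters) v u (old∈ p) (new∈ u))) (tl⇒inv φ u (new∈ u))))
    where u = other v

  sat-before : ∀ d u v {p q w} (ρ : Env Γ _) {i j} → ρ u p ≡ i → ρ v q ≡ j →
               Sat w ρ (before d u v p q) ⇔ Before d i j
  sat-before fwd u v ρ refl refl = ⇔-id _
  sat-before bwd u v ρ refl refl = ⇔-id _

  sat-someAmid : ∀ bs u v {p q w} (ρ : Env Γ _) {i j} → ρ u p ≡ i → ρ v q ≡ j →
                 Sat w ρ (someAmid bs u v p q) ⇔ (∃[ k ] (Amid i j k × lookup w k ∈ bs))
  sat-someAmid []       u v ρ refl refl = mk⇔ (λ lt → contradiction lt (<-irrefl refl)) λ ()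
  sat-someAmid (b ∷ bs) u v {w = w} ρ {i} {j} refl refl = mk⇔
    [ [ (λ (k , i<k , k<j , eq) → k , inj₁ (i<k , k<j) , here eq)
      , (λ (k , j<k , k<i , eq) → k , inj₂ (j<k , k<i) , here eq) ]
    , (λ s → let k , p , k∈ = to ih s in k , p , there k∈) ]
    λ { (k , inj₁ (i<k , k<j) , here eq) → inj₁ (inj₁ (k , i<k , k<j , eq))
      ; (k , inj₂ (j<k , k<i) , here eq) → inj₁ (inj₂ (k , j<k , k<i , eq))
      ; (k , p , there k∈) → inj₂ (from ih (k , p , k∈)) }
    where ih = sat-someAmid bs u v {w = w} ρ refl refl

  avoids⇔ : ∀ B w {i j} → (¬ (∃[ k ] (Amid i j k × lookup w k ∈ filter (T? ∘ B) letters))) ⇔ Avoids B w i j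
  avoids⇔ B w = mk⇔
    (λ none k p b → none (k , p , ∈-filter⁺ (T? ∘ B) (complete (lookup w k)) b))
    (λ avoids (k , p , k∈) → avoids k p (proj₂ (∈-filter⁻ (T? ∘ B) {xs = letters} k∈)))

  sat-tl⇒inv : ∀ φ v {p w i} (ρ : Env Γ _) → Assigns ρ v i → Sat w ρ (tl⇒inv φ v p) ⇔ ⟦ φ ⟧ w i
  sat-tl⇒inv ⊥ₜ           v ρ ρv = mk⇔ (<-irrefl refl) λ ()
  sat-tl⇒inv (letter a)   v {p} {w} ρ ρv =
    mk⇔ (trans (cong (lookup w) (sym (ρv p)))) (trans (cong (lookup w) (ρv p)))
  sat-tl⇒inv (neg φ)      v ρ ρv = ¬-cong-⇔ (sat-tl⇒inv φ v ρ ρv)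
  sat-tl⇒inv (φ ∧ ψ)      v ρ ρv = sat-tl⇒inv φ v ρ ρv ×-⇔ sat-tl⇒inv ψ v ρ ρv
  sat-tl⇒inv (φ ∨ ψ)      v ρ ρv = sat-tl⇒inv φ v ρ ρv ⊎-⇔ sat-tl⇒inv ψ v ρ ρv
  sat-tl⇒inv (next d B φ) v {w = w} ρ ρv = ∃-cong λ j →
    let ρ′  = ρ [ other v ↦ j ]
        old = assigns-old ρ {j = j} (≢other v) ρv _
        new = assigns-new ρ (other v) {j} _
    in sat-before d v (other v) {w = w} ρ′ old new
       ×-⇔ (avoids⇔ B w ⇔-∘ ¬-cong-⇔ (sat-someAmid (filter (T? ∘ B) letters) v (other v) {w = w} ρ′ old new)
       ×-⇔ sat-tl⇒inv φ (other v) ρ′ (assigns-new ρ (other v)))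

  -- `order` always reads from variable `zero` to `suc zero`, hence the mirrored order in one case
  -- and a constant when a variable meets itself.
  compare : Maybe Dir → Var → Var → Tree A
  compare o zero       zero       = leaf (does (o ≟ᵒ nothing))
  compare o zero       (suc zero) = atom (order o)
  compare o (suc zero) zero       = atom (order (Maybe.map reverse o))
  compare o (suc zero) (suc zero) = leaf (does (o ≟ᵒ nothing))

  complement : Tree A → Tree A
  complement t = graft t (leaf false) (leaf true)

  -- A quantified subformula collapses to one unary atom at the variable it leaves free. In the
  -- clause for `rel` the order is tested separately because `many` is symmetric.
  th⇒tree : Formula (Th A) Γ → Tree A
  th⇒tree (letter a u p)        = atom (unary u (letter a))
  th⇒tree (less u v p q)        = compare (just fwd) u v
  th⇒tree (equal u v p q)       = compare nothing u v
  th⇒tree (rel (a , n) u v p q) = graft (compare (just fwd) u v) (atom (many a n)) (leaf false)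
  th⇒tree (neg φ)               = complement (th⇒tree φ)
  th⇒tree (and φ ψ)             = graft (th⇒tree φ) (th⇒tree ψ) (leaf false)
  th⇒tree (or φ ψ)              = graft (th⇒tree φ) (leaf true) (th⇒tree ψ)
  th⇒tree (all′ v φ)            = complement (atom (unary (other v) (exists v (complement (th⇒tree φ)))))
  th⇒tree (ex v φ)              = atom (unary (other v) (exists v (th⇒tree φ)))

  T-atom : ∀ a w e → T (eval (atom a) w e) ⇔ ⟦ a ⟧ᵃ w e
  T-atom a w e with ⟦ a ⟧ᵃ? w e
  ... | yes p = mk⇔ (λ _ → p) _
  ... | no ¬p = mk⇔ (λ ()) ¬p

  T-complement : ∀ t w e → T (eval (complement t) w e) ⇔ (¬ T (eval t w e))
  T-complement t w e rewrite eval-graft t (leaf false) (leaf true) w e with eval t w e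
  ... | true  = mk⇔ (λ ()) (λ ¬t → ¬t _)
  ... | false = mk⇔ (λ _ ()) _

  T-and : ∀ s t w e → T (eval (graft s t (leaf false)) w e) ⇔ (T (eval s w e) × T (eval t w e))
  T-and s t w e rewrite eval-graft s t (leaf false) w e with eval s w e
  ... | true  = mk⇔ (_ ,_) proj₂
  ... | false = mk⇔ (λ ()) (λ ())

  T-or : ∀ s t w e → T (eval (graft s (leaf true) t) w e) ⇔ (T (eval s w e) ⊎ T (eval t w e))
  T-or s t w e rewrite eval-graft s (leaf true) t w e with eval s w e
  ... | true  = mk⇔ inj₁ _
  ... | false = mk⇔ inj₂ λ { (inj₁ ()) ; (inj₂ x) → x }

  T-self : ∀ {n} o (i : Fin n) → T (does (o ≟ᵒ nothing)) ⇔ Cmp o i i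
  T-self nothing    i = mk⇔ (λ _ → refl) _
  T-self (just fwd) i = mk⇔ (λ ()) (<-irrefl refl)
  T-self (just bwd) i = mk⇔ (λ ()) (<-irrefl refl)

  T-compare : ∀ o u v w e → T (eval (compare o u v) w e) ⇔ Cmp o (e u) (e v)
  T-compare o zero       (suc zero) w e = T-atom (order o) w e
  T-compare o (suc zero) zero       w e = cmp-reverse o ⇔-∘ T-atom (order (Maybe.map reverse o)) w e
  T-compare o zero       zero       w e = T-self o _
  T-compare o (suc zero) (suc zero) w e = T-self o _

  -- Constrains `e` only within the scope, so every valuation agrees with the empty environment of a
  -- sentence.
  Agrees : ∀ {n} → Env Γ n → Valuation n → Set
  Agrees ρ e = ∀ u → Assigns ρ u (e u)

  agrees-update : ∀ {n} {ρ : Env Γ n} {e} v j → Agrees ρ e → Agrees (ρ [ v ↦ j ]) (e ⟨ v ≔ j ⟩)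
  agrees-update {ρ = ρ} {e} v j agrees u p = go (u Fin.≟ v)
    where
    go : Dec (u ≡ v) → (ρ [ v ↦ j ]) u p ≡ (e ⟨ v ≔ j ⟩) u
    go (yes refl) = trans (assigns-new ρ v p) (sym (≔-same e v))
    go (no u≢v)   = trans (assigns-old ρ u≢v (agrees u) p) (sym (≔-old e u≢v))

  sat-tree : ∀ (φ : Formula (Th A) Γ) {w} (ρ : Env Γ _) e → Agrees ρ e → Sat w ρ φ ⇔ T (eval (th⇒tree φ) w e)
  sat-tree (letter a u p) {w} ρ e agrees =
    mk⇔ (from (T-atom (unary u (letter a)) w e) ∘ trans (cong (lookup w) (sym (agrees u p))))
        (trans (cong (lookup w) (agrees u p)) ∘ to (T-atom (unary u (letter a)) w e))
  sat-tree (less u v p q) {w} ρ e agrees rewrite agrees u p | agrees v q = ⇔-sym (T-compare (just fwd) u v w e)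
  sat-tree (equal u v p q) {w} ρ e agrees rewrite agrees u p | agrees v q = ⇔-sym (T-compare nothing u v w e)
  sat-tree (rel (a , n) u v p q) {w} ρ e agrees rewrite agrees u p | agrees v q =
    ⇔-sym (T-and (compare (just fwd) u v) (atom (many a n)) w e)
    ⇔-∘ (mk⇔ (λ (u<v , n≤) → from (T-compare (just fwd) u v w e) u<v
                           , from (T-atom (many a n) w e) (to (many⇔ u v u<v) n≤))
             (λ (s , s′) → let u<v = to (T-compare (just fwd) u v w e) s in
                u<v , from (many⇔ u v u<v) (to (T-atom (many a n) w e) s′))
    ⇔-∘ atLeast⇔count _≟_ w)
    where
    -- The hypothesis excludes `u = v`, where `many` would measure the interval between the two
    -- different variables.
    many⇔ : ∀ u v → e u Fin.< e v → (n ≤ #[ a ] w (e u) (e v)) ⇔ ⟦ many a n ⟧ᵃ w e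
    many⇔ zero       zero       u<u = contradiction u<u (<-irrefl refl)
    many⇔ zero       (suc zero) _   = ⇔-id _
    many⇔ (suc zero) zero       _   = mk⇔
      (subst (n ≤_) (count-sym _≟_ a w _ _)) (subst (n ≤_) (count-sym _≟_ a w _ _))
    many⇔ (suc zero) (suc zero) u<u = contradiction u<u (<-irrefl refl)
  sat-tree (neg φ) {w} ρ e agrees =
    ⇔-sym (T-complement (th⇒tree φ) w e) ⇔-∘ ¬-cong-⇔ (sat-tree φ ρ e agrees)
  sat-tree (and φ ψ) {w} ρ e agrees =
    ⇔-sym (T-and (th⇒tree φ) (th⇒tree ψ) w e) ⇔-∘ (sat-tree φ ρ e agrees ×-⇔ sat-tree ψ ρ e agrees)
  sat-tree (or φ ψ) {w} ρ e agrees =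
    ⇔-sym (T-or (th⇒tree φ) (th⇒tree ψ) w e) ⇔-∘ (sat-tree φ ρ e agrees ⊎-⇔ sat-tree ψ ρ e agrees)
  sat-tree (all′ v φ) {w} ρ e agrees =
    ⇔-sym (T-complement (atom (unary (other v) (exists v (complement (th⇒tree φ))))) w e)
    ⇔-∘ (¬-cong-⇔ (⇔-sym (T-atom (unary (other v) (exists v (complement (th⇒tree φ)))) w e)
                   ⇔-∘ ⇔-sym (exists⇔ v (complement (th⇒tree φ)) e))
    ⇔-∘ (∀⇔¬∃¬
    ⇔-∘ ∀-cong λ j → sat-tree φ (ρ [ v ↦ j ]) (e ⟨ v ≔ j ⟩) (agrees-update v j agrees)))
    where
    ∀⇔¬∃¬ : (∀ j → T (eval (th⇒tree φ) w (e ⟨ v ≔ j ⟩))) ⇔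
            (¬ (∃[ j ] T (eval (complement (th⇒tree φ)) w (e ⟨ v ≔ j ⟩))))
    ∀⇔¬∃¬ = mk⇔
      (λ ∀φ (j , s) → to (T-complement (th⇒tree φ) w _) s (∀φ j))
      -- Constructively valid because the truth of a tree is a Boolean.
      (λ ¬∃ j → decidable-stable (T? _) λ ¬s → ¬∃ (j , from (T-complement (th⇒tree φ) w _) ¬s))
  sat-tree (ex v φ) {w} ρ e agrees =
    ⇔-sym (T-atom (unary (other v) (exists v (th⇒tree φ))) w e)
    ⇔-∘ (⇔-sym (exists⇔ v (th⇒tree φ) e)
    ⇔-∘ ∃-cong λ j → sat-tree φ (ρ [ v ↦ j ]) (e ⟨ v ≔ j ⟩) (agrees-update v j agrees))

  -- An atom would need a position of the empty word, and the quantifiers are constant there.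
  sat-[]? : ∀ {V : Vocabulary A} (φ : Formula V Γ) (ρ : Env Γ 0) → Dec (Sat [] ρ φ)
  sat-[]? (letter a u p)  ρ = contradiction (ρ u p) λ ()
  sat-[]? (less u v p q)  ρ = contradiction (ρ u p) λ ()
  sat-[]? (equal u v p q) ρ = contradiction (ρ u p) λ ()
  sat-[]? (rel R u v p q) ρ = contradiction (ρ u p) λ ()
  sat-[]? (neg φ)         ρ = ¬? (sat-[]? φ ρ)
  sat-[]? (and φ ψ)       ρ = sat-[]? φ ρ ×-dec sat-[]? ψ ρ
  sat-[]? (or φ ψ)        ρ = sat-[]? φ ρ ⊎-dec sat-[]? ψ ρ
  sat-[]? (all′ v φ)      ρ = yes λ ()
  sat-[]? (ex v φ)        ρ = no λ ()

  nonempty : Sentence (Inv A)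
  nonempty = ex zero (equal zero zero (new∈ {Subset.⊥} zero) (new∈ {Subset.⊥} zero))

  -- Both quantifiers are vacuous: `φ` is closed, but its tree needs values for both variables.
  onNonempty : Sentence (Th A) → Sentence (Inv A)
  onNonempty φ = ex zero (tl⇒inv (exists (suc zero) (th⇒tree φ)) zero (new∈ {Subset.⊥} zero))

  -- onNonempty starts from a position, so the truth value on the empty word is hard-wired.
  th⇒inv : Sentence (Th A) → Sentence (Inv A)
  th⇒inv φ = if does (sat-[]? φ emptyEnv) then or (onNonempty φ) (neg nonempty) else onNonempty φ

  sat-onNonempty : ∀ φ x xs → ((x ∷ xs) ⊨ φ) ⇔ ((x ∷ xs) ⊨ onNonempty φ)
  sat-onNonempty φ x xs = mk⇔
    -- Any position would do in place of `zero`, since the value of the tree does not depend on the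
    -- valuation.
    (λ s → zero , from (first zero) (from (second zero) (zero , to (tree _) s)))
    (λ (i , s) → let j , s′ = to (second i) (to (first i) s) in from (tree _) s′)
    where
    w = x ∷ xs
    ψ = exists (suc zero) (th⇒tree φ)
    tree : ∀ e → (w ⊨ φ) ⇔ T (eval (th⇒tree φ) w e)
    tree e = sat-tree φ emptyEnv e λ u u∈⊥ → ⊥-elim (∉⊥ u∈⊥)
    first : ∀ i → Sat w (emptyEnv [ zero ↦ i ]) (tl⇒inv ψ zero (new∈ {Subset.⊥} zero)) ⇔ ⟦ ψ ⟧ w i
    first i = sat-tl⇒inv ψ zero (emptyEnv [ zero ↦ i ]) (assigns-new emptyEnv zero)
    second : ∀ i → ⟦ ψ ⟧ w i ⇔ (∃[ j ] T (eval (th⇒tree φ) w ((λ _ → i) ⟨ suc zero ≔ j ⟩)))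
    second i = exists⇔ (suc zero) (th⇒tree φ) (λ _ → i)

  sat-th⇒inv : ∀ φ w → (w ⊨ φ) ⇔ (w ⊨ th⇒inv φ)
  sat-th⇒inv φ [] with sat-[]? φ emptyEnv
  ... | yes s = mk⇔ (λ _ → inj₂ λ ()) λ _ → s
  ... | no ¬s = mk⇔ (λ s → contradiction s ¬s) λ ()
  sat-th⇒inv φ (x ∷ xs) with sat-[]? φ emptyEnv
  ... | yes _ = mk⇔ inj₁ [ id , (λ empty → contradiction (zero , refl) empty) ] ⇔-∘ sat-onNonempty φ x xs
  ... | no _  = sat-onNonempty φ x xs

-- Equality of the two classes

definable-map : ∀ {ℓ} {V W : Vocabulary A} (f : Sentence V → Sentence W) →
                (∀ φ w → (w ⊨ φ) ⇔ (w ⊨ f φ)) → (L : Pred (Word A) ℓ) → Definable V L → Definable W L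
definable-map f f⇔ L (φ , L⊆ , ⊆L) = f φ , (λ {w} → to (f⇔ φ w) ∘ L⊆) , λ {w} → ⊆L ∘ from (f⇔ φ w)

theorem1 : ∀ {ℓ : Level} (A : Set) (m : ℕ) → A ↔ Fin m →
    (L : Pred (Word A) ℓ) → Definable (Inv A) L ⇔ Definable (Th A) L
theorem1 A m A↔Fin L = mk⇔
  (definable-map inv⇒th (λ φ w → sat-inv⇒th φ {w} emptyEnv) L)
  (definable-map th⇒inv sat-th⇒inv L)
  where
  open Inverse A↔Fin using (inverseʳ) renaming (from to element)
  letters : List A
  letters = map element (allFin m)
  complete : Complete letters
  complete a = subst (_∈ letters) (inverseʳ refl) (∈-map⁺ element (∈-allFin (Inverse.to A↔Fin a)))
  open Inv⇐Th (via-injection (↔⇒↣ A↔Fin) Fin._≟_) letters complete
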